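{- Let $\mathsf{C}$ be a category with binary coproducts, $F\colon\mathsf{C}\to\mathsf{C}$ a functor and $(T,\mu,\eta)$ a monad on $\mathsf{C}$ such that: (i) $F$ lifts to $\mathcal{K}l(T)$ via a distributive law $\lambda\colon FT\Rightarrow TF$; (ii) there is an initial $(F(-)+X)$-algebra for every object $X$ and a terminal $F$-coalgebra; (iii) the category $\mathsf{Alg}(F)$ of $F$-algebras has binary coproducts. Let $\bar{T}_B\colon\mathsf{Alg}_B(F)\to\mathsf{Alg}_B(F)$ be the functor on Bloom $F$-algebras defined in the context. Then $(\bar{T}_B,\bar\mu^B,\bar\eta^B)$ is a monad on $\mathsf{Alg}_B(F)$, where for every Bloom algebra $(a\colon FA\to A,(-)^\dagger)$ the components are $$\bar\mu^B_{(a,(-)^\dagger)}=\mu_A\colon \bar{T}_B^2(a,(-)^\dagger)\to\bar{T}_B(a,(-)^\dagger),\qquad \bar\eta^B_{(a,(-)^\dagger)}=\eta_A\colon (a,(-)^\dagger)\to\bar{T}_B(a,(-)^\dagger).$$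
   Context: Distributive law: a natural transformation $\lambda\colon FT\Rightarrow TF$ with $\lambda\circ F\eta=\eta_F$ and $\lambda\circ F\mu=\mu_F\circ T\lambda\circ\lambda_T$. Bloom $F$-algebra: a pair $(a\colon FA\to A,(-)^\dagger)$, where $(-)^\dagger$ assigns to every $F$-coalgebra $e\colon X\to FX$ a map $e^\dagger\colon X\to A$ such that $e^\dagger=a\circ F(e^\dagger)\circ e$, and such that for every coalgebra homomorphism $h\colon X\to Y$ from $e\colon X\to FX$ to $f\colon Y\to FY$ (i.e. $f\circ h=Fh\circ e$) one has $f^\dagger\circ h=e^\dagger$. A homomorphism from $(a\colon FA\to A,(-)^\dagger)$ to $(b\colon FB\to B,(-)^\ddagger)$ is a map $h\colon A\to B$ with $b\circ Fh=h\circ a$ and $h\circ e^\dagger=e^\ddagger$ for every $F$-coalgebra $e$. $\mathsf{Alg}_B(F)$ is the category of Bloom algebras and their homomorphisms. The functor $\bar{T}_B$: for an $F$-algebra $a\colon FA\to A$ put $\bar{T}(a)=Ta\circ\lambda_A\colon FTA\to TFA\to TA$. Then $\bar{T}_B(a\colon FA\to A,(-)^\dagger)=(\bar{T}(a)\colon FTA\to TA,(-)^\ddagger)$, where $e^\ddagger=\eta_A\circ e^\dagger$ for every coalgebra $e\colon X\to FX$; on a homomorphism $h$, $\bar{T}_B(h)=T(h)$. -}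

module Defs where

open import Level using (Level; _⊔_; suc)
open import Relation.Binary.Bundles using (Setoid)
open import Relation.Binary.Structures using (IsEquivalence)
import Relation.Binary.Reasoning.Setoid as SetoidReasoning

-- Categories are enriched in setoids: morphisms are compared by _≈_, objects
-- are never compared.
record Category (o ℓ e : Level) : Set (suc (o ⊔ ℓ ⊔ e)) where
  infixr 9 _∘_
  infix 4 _≈_ _⇒_
  field
    Obj  : Set o
    _⇒_ : Obj → Obj → Set ℓ
    _≈_  : ∀ {A B} → A ⇒ B → A ⇒ B → Set e
    id   : ∀ {A} → A ⇒ A
    _∘_  : ∀ {A B C} → B ⇒ C → A ⇒ B → A ⇒ C

    equiv     : ∀ {A B} → IsEquivalence (_≈_ {A} {B})
    ∘-resp-≈  : ∀ {A B C} {f f′ : B ⇒ C} {g g′ : A ⇒ B} →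
                f ≈ f′ → g ≈ g′ → f ∘ g ≈ f′ ∘ g′
    assoc     : ∀ {A B C D} {f : A ⇒ B} {g : B ⇒ C} {h : C ⇒ D} →
                (h ∘ g) ∘ f ≈ h ∘ (g ∘ f)
    identityˡ : ∀ {A B} {f : A ⇒ B} → id ∘ f ≈ f
    identityʳ : ∀ {A B} {f : A ⇒ B} → f ∘ id ≈ f

  module Equiv {A B : Obj} = IsEquivalence (equiv {A} {B})
  open Equiv public using () renaming (refl to ≈-refl; sym to ≈-sym; trans to ≈-trans)

  hom-setoid : (A B : Obj) → Setoid ℓ e
  hom-setoid A B = record { Carrier = A ⇒ B ; _≈_ = _≈_ ; isEquivalence = equiv }

  module HomReasoning {A B : Obj} = SetoidReasoning (hom-setoid A B)

  ∘-congˡ : ∀ {A B C} {f : B ⇒ C} {g g′ : A ⇒ B} → g ≈ g′ → f ∘ g ≈ f ∘ g′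
  ∘-congˡ = ∘-resp-≈ ≈-refl

  ∘-congʳ : ∀ {A B C} {f f′ : B ⇒ C} {g : A ⇒ B} → f ≈ f′ → f ∘ g ≈ f′ ∘ g
  ∘-congʳ p = ∘-resp-≈ p ≈-refl

record Functor {o ℓ e o′ ℓ′ e′ : Level}
               (C : Category o ℓ e) (D : Category o′ ℓ′ e′)
               : Set (o ⊔ ℓ ⊔ e ⊔ o′ ⊔ ℓ′ ⊔ e′) where
  private
    module C = Category C
    module D = Category D
  field
    F₀ : C.Obj → D.Obj
    F₁ : ∀ {A B} → A C.⇒ B → F₀ A D.⇒ F₀ B

    identity     : ∀ {A} → F₁ (C.id {A}) D.≈ D.id
    homomorphism : ∀ {X Y Z} {f : X C.⇒ Y} {g : Y C.⇒ Z} →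
                   F₁ (g C.∘ f) D.≈ F₁ g D.∘ F₁ f
    F-resp-≈     : ∀ {A B} {f g : A C.⇒ B} → f C.≈ g → F₁ f D.≈ F₁ g

idF : {o ℓ e : Level} {C : Category o ℓ e} → Functor C C
idF {C = C} = record
  { F₀ = λ A → A
  ; F₁ = λ f → f
  ; identity = ≈-refl
  ; homomorphism = ≈-refl
  ; F-resp-≈ = λ p → p
  }
  where open Category C

infixr 9 _∘F_
_∘F_ : {o ℓ e o′ ℓ′ e′ o″ ℓ″ e″ : Level}
       {C : Category o ℓ e} {D : Category o′ ℓ′ e′} {E : Category o″ ℓ″ e″} →
       Functor D E → Functor C D → Functor C E
_∘F_ {E = E} G F = record
  { F₀ = λ A → G.F₀ (F.F₀ A)
  ; F₁ = λ f → G.F₁ (F.F₁ f)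
  ; identity = ≈-trans (G.F-resp-≈ F.identity) G.identity
  ; homomorphism = ≈-trans (G.F-resp-≈ F.homomorphism) G.homomorphism
  ; F-resp-≈ = λ p → G.F-resp-≈ (F.F-resp-≈ p)
  }
  where
    open Category E
    module G = Functor G
    module F = Functor F

record NaturalTransformation {o ℓ e o′ ℓ′ e′ : Level}
                             {C : Category o ℓ e} {D : Category o′ ℓ′ e′}
                             (F G : Functor C D)
                             : Set (o ⊔ ℓ ⊔ e ⊔ o′ ⊔ ℓ′ ⊔ e′) where
  private
    module C = Category C
    module D = Category D
    module F = Functor F
    module G = Functor G
  field
    component : (A : C.Obj) → F.F₀ A D.⇒ G.F₀ A
    natural   : ∀ {A B} (f : A C.⇒ B) →
                component B D.∘ F.F₁ f D.≈ G.F₁ f D.∘ component A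

record IsMonad {o ℓ e : Level} {C : Category o ℓ e} (T : Functor C C)
               (μ : NaturalTransformation (T ∘F T) T)
               (η : NaturalTransformation idF T)
               : Set (o ⊔ ℓ ⊔ e) where
  open Category C
  private
    module T = Functor T
    module μ = NaturalTransformation μ
    module η = NaturalTransformation η
  field
    μ-assoc : ∀ A → μ.component A ∘ T.F₁ (μ.component A) ≈ μ.component A ∘ μ.component (T.F₀ A)
    μ-Tη    : ∀ A → μ.component A ∘ T.F₁ (η.component A) ≈ id
    μ-ηT    : ∀ A → μ.component A ∘ η.component (T.F₀ A) ≈ id

record DistributiveLaw {o ℓ e : Level} {C : Category o ℓ e} (F T : Functor C C)
                       (μ : NaturalTransformation (T ∘F T) T)
                       (η : NaturalTransformation idF T)
                       : Set (o ⊔ ℓ ⊔ e) where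
  open Category C
  private
    module F = Functor F
    module T = Functor T
    module μ = NaturalTransformation μ
    module η = NaturalTransformation η
  field
    transformation : NaturalTransformation (F ∘F T) (T ∘F F)
  open NaturalTransformation transformation public
  field
    law-η : ∀ A → component A ∘ F.F₁ (η.component A) ≈ η.component (F.F₀ A)
    law-μ : ∀ A → component A ∘ F.F₁ (μ.component A)
                  ≈ μ.component (F.F₀ A) ∘ T.F₁ (component A) ∘ component (T.F₀ A)

record Initial {o ℓ e : Level} (C : Category o ℓ e) : Set (o ⊔ ℓ ⊔ e) where
  open Category C
  field
    ⊥        : Obj
    !        : ∀ {A} → ⊥ ⇒ A
    !-unique : ∀ {A} (f : ⊥ ⇒ A) → ! ≈ f

record Terminal {o ℓ e : Level} (C : Category o ℓ e) : Set (o ⊔ ℓ ⊔ e) where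
  open Category C
  field
    ⊤        : Obj
    !        : ∀ {A} → A ⇒ ⊤
    !-unique : ∀ {A} (f : A ⇒ ⊤) → ! ≈ f

record Coproduct {o ℓ e : Level} (C : Category o ℓ e) (A B : Category.Obj C)
                 : Set (o ⊔ ℓ ⊔ e) where
  open Category C
  field
    A+B   : Obj
    i₁    : A ⇒ A+B
    i₂    : B ⇒ A+B
    [_,_] : ∀ {X} → A ⇒ X → B ⇒ X → A+B ⇒ X

    inject₁ : ∀ {X} {f : A ⇒ X} {g : B ⇒ X} → [ f , g ] ∘ i₁ ≈ f
    inject₂ : ∀ {X} {f : A ⇒ X} {g : B ⇒ X} → [ f , g ] ∘ i₂ ≈ g
    unique  : ∀ {X} {f : A ⇒ X} {g : B ⇒ X} {h : A+B ⇒ X} →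
              h ∘ i₁ ≈ f → h ∘ i₂ ≈ g → [ f , g ] ≈ h

BinaryCoproducts : {o ℓ e : Level} → Category o ℓ e → Set (o ⊔ ℓ ⊔ e)
BinaryCoproducts C = (A B : Category.Obj C) → Coproduct C A B

-- The endofunctor F(-) + X.
_⟨-⟩+_ : {o ℓ e : Level} {C : Category o ℓ e} (F : Functor C C)
         (X : Category.Obj C) → BinaryCoproducts C → Functor C C
_⟨-⟩+_ {C = C} F X coproducts = record
  { F₀ = λ A → A+B {A}
  ; F₁ = λ f → [ i₁ ∘ F.F₁ f , i₂ ]
  ; identity = unique
      (≈-trans identityˡ (≈-sym (≈-trans (∘-congˡ F.identity) identityʳ)))
      identityˡ
  ; homomorphism = unique
      (≈-trans assoc (≈-trans (∘-congˡ inject₁) (≈-trans (≈-sym assoc)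
        (≈-trans (∘-congʳ inject₁) (≈-trans assoc (∘-congˡ (≈-sym F.homomorphism)))))))
      (≈-trans assoc (≈-trans (∘-congˡ inject₂) inject₂))
  ; F-resp-≈ = λ p → unique
      (≈-trans inject₁ (∘-congˡ (F.F-resp-≈ (≈-sym p))))
      inject₂
  }
  where
    open Category C
    module F = Functor F
    open module Sum {A} = Coproduct (coproducts (F.F₀ A) X)

module _ {o ℓ e : Level} {C : Category o ℓ e} (F : Functor C C) where
  open Category C
  open Functor F

  record Algebra : Set (o ⊔ ℓ) where
    field
      carrier   : Obj
      structure : F₀ carrier ⇒ carrier

  record Coalgebra : Set (o ⊔ ℓ) where
    field
      carrier   : Obj
      structure : carrier ⇒ F₀ carrier

  record AlgebraHom (A B : Algebra) : Set (ℓ ⊔ e) where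
    private
      module A = Algebra A
      module B = Algebra B
    field
      map      : A.carrier ⇒ B.carrier
      commutes : B.structure ∘ F₁ map ≈ map ∘ A.structure

  record CoalgebraHom (X Y : Coalgebra) : Set (ℓ ⊔ e) where
    private
      module X = Coalgebra X
      module Y = Coalgebra Y
    field
      map      : X.carrier ⇒ Y.carrier
      commutes : Y.structure ∘ map ≈ F₁ map ∘ X.structure

  -- The assignment (-)† is not required to respect _≈_ on coalgebra structures:
  -- this follows from †-functorial, applied to the homomorphism id.
  record BloomAlgebra : Set (o ⊔ ℓ ⊔ e) where
    field
      algebra : Algebra
    open Algebra algebra public
    field
      _†           : (E : Coalgebra) → Coalgebra.carrier E ⇒ carrier
      †-solution   : ∀ E → E † ≈ structure ∘ F₁ (E †) ∘ Coalgebra.structure E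
      †-functorial : ∀ {D E} (h : CoalgebraHom D E) → E † ∘ CoalgebraHom.map h ≈ D †

  record BloomHom (A B : BloomAlgebra) : Set (o ⊔ ℓ ⊔ e) where
    private
      module A = BloomAlgebra A
      module B = BloomAlgebra B
    field
      algebraHom : AlgebraHom A.algebra B.algebra
    open AlgebraHom algebraHom public
    field
      preserves-† : ∀ E → map ∘ E A.† ≈ E B.†

  private
    id-algebraHom : ∀ {A} → AlgebraHom A A
    id-algebraHom = record
      { map = id
      ; commutes = ≈-trans (∘-congˡ identity) (≈-trans identityʳ (≈-sym identityˡ))
      }

    ∘-algebraHom : ∀ {A B D} → AlgebraHom B D → AlgebraHom A B → AlgebraHom A D
    ∘-algebraHom {A} {B} {D} g f = record
      { map = g.map ∘ f.map
      ; commutes = begin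
          D.structure ∘ F₁ (g.map ∘ f.map)      ≈⟨ ∘-congˡ homomorphism ⟩
          D.structure ∘ F₁ g.map ∘ F₁ f.map     ≈⟨ assoc ⟨
          (D.structure ∘ F₁ g.map) ∘ F₁ f.map   ≈⟨ ∘-congʳ g.commutes ⟩
          (g.map ∘ B.structure) ∘ F₁ f.map      ≈⟨ assoc ⟩
          g.map ∘ B.structure ∘ F₁ f.map        ≈⟨ ∘-congˡ f.commutes ⟩
          g.map ∘ f.map ∘ A.structure           ≈⟨ assoc ⟨
          (g.map ∘ f.map) ∘ A.structure         ∎
      }
      where
        open HomReasoning
        module A = Algebra A
        module B = Algebra B
        module D = Algebra D
        module f = AlgebraHom f
        module g = AlgebraHom g

  Alg : Category (o ⊔ ℓ) (ℓ ⊔ e) e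
  Alg = record
    { Obj = Algebra
    ; _⇒_ = AlgebraHom
    ; _≈_ = λ f g → AlgebraHom.map f ≈ AlgebraHom.map g
    ; id = id-algebraHom
    ; _∘_ = ∘-algebraHom
    ; equiv = record { refl = ≈-refl ; sym = ≈-sym ; trans = ≈-trans }
    ; ∘-resp-≈ = ∘-resp-≈
    ; assoc = assoc
    ; identityˡ = identityˡ
    ; identityʳ = identityʳ
    }

  Coalg : Category (o ⊔ ℓ) (ℓ ⊔ e) e
  Coalg = record
    { Obj = Coalgebra
    ; _⇒_ = CoalgebraHom
    ; _≈_ = λ f g → CoalgebraHom.map f ≈ CoalgebraHom.map g
    ; id = record
      { map = id
      ; commutes = ≈-trans identityʳ (≈-sym (≈-trans (∘-congʳ identity) identityˡ))
      }
    ; _∘_ = λ g f → record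
      { map = CoalgebraHom.map g ∘ CoalgebraHom.map f
      ; commutes = ≈-trans (≈-sym assoc)
          (≈-trans (∘-congʳ (CoalgebraHom.commutes g))
          (≈-trans assoc
          (≈-trans (∘-congˡ (CoalgebraHom.commutes f))
          (≈-trans (≈-sym assoc) (∘-congʳ (≈-sym homomorphism))))))
      }
    ; equiv = record { refl = ≈-refl ; sym = ≈-sym ; trans = ≈-trans }
    ; ∘-resp-≈ = ∘-resp-≈
    ; assoc = assoc
    ; identityˡ = identityˡ
    ; identityʳ = identityʳ
    }

  AlgB : Category (o ⊔ ℓ ⊔ e) (o ⊔ ℓ ⊔ e) e
  AlgB = record
    { Obj = BloomAlgebra
    ; _⇒_ = BloomHom
    ; _≈_ = λ f g → BloomHom.map f ≈ BloomHom.map g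
    ; id = record { algebraHom = id-algebraHom ; preserves-† = λ _ → identityˡ }
    ; _∘_ = λ g f → record
      { algebraHom = ∘-algebraHom (BloomHom.algebraHom g) (BloomHom.algebraHom f)
      ; preserves-† = λ E → ≈-trans assoc
          (≈-trans (∘-congˡ (BloomHom.preserves-† f E)) (BloomHom.preserves-† g E))
      }
    ; equiv = record { refl = ≈-refl ; sym = ≈-sym ; trans = ≈-trans }
    ; ∘-resp-≈ = ∘-resp-≈
    ; assoc = assoc
    ; identityˡ = identityˡ
    ; identityʳ = identityʳ
    }

module _ {o ℓ e : Level} {C : Category o ℓ e} {F T : Functor C C}
         {μ : NaturalTransformation (T ∘F T) T} {η : NaturalTransformation idF T}
         (dist : DistributiveLaw F T μ η) where
  open Category C
  private
    module F = Functor F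
    module T = Functor T
    module η = NaturalTransformation η
    module dist = DistributiveLaw dist

  T̄ : Algebra F → Algebra F
  T̄ A = record
    { carrier   = T.F₀ carrier
    ; structure = T.F₁ structure ∘ dist.component carrier
    }
    where open Algebra A

  T̄B₀ : BloomAlgebra F → BloomAlgebra F
  T̄B₀ A = record
    { algebra = T̄ algebra
    ; _† = λ E → η.component carrier ∘ E †
    ; †-solution = solution
    ; †-functorial = λ h → ≈-trans assoc (∘-congˡ (†-functorial h))
    }
    where
      open BloomAlgebra A
      open HomReasoning

      solution : ∀ E → η.component carrier ∘ E †
                       ≈ (T.F₁ structure ∘ dist.component carrier)
                         ∘ F.F₁ (η.component carrier ∘ E †) ∘ Coalgebra.structure E
      solution E = begin
        ηA ∘ E †                                    ≈⟨ ∘-congˡ (†-solution E) ⟩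
        ηA ∘ structure ∘ F.F₁ (E †) ∘ c             ≈⟨ assoc ⟨
        (ηA ∘ structure) ∘ F.F₁ (E †) ∘ c           ≈⟨ ∘-congʳ (η.natural structure) ⟩
        (T.F₁ structure ∘ η.component (F.F₀ carrier)) ∘ F.F₁ (E †) ∘ c
          ≈⟨ ∘-congʳ (∘-congˡ (dist.law-η carrier)) ⟨
        (T.F₁ structure ∘ λA ∘ F.F₁ ηA) ∘ F.F₁ (E †) ∘ c
          ≈⟨ ∘-congʳ assoc ⟨
        ((T.F₁ structure ∘ λA) ∘ F.F₁ ηA) ∘ F.F₁ (E †) ∘ c
          ≈⟨ assoc ⟩
        (T.F₁ structure ∘ λA) ∘ F.F₁ ηA ∘ F.F₁ (E †) ∘ c
          ≈⟨ ∘-congˡ assoc ⟨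
        (T.F₁ structure ∘ λA) ∘ (F.F₁ ηA ∘ F.F₁ (E †)) ∘ c
          ≈⟨ ∘-congˡ (∘-congʳ F.homomorphism) ⟨
        (T.F₁ structure ∘ λA) ∘ F.F₁ (ηA ∘ E †) ∘ c  ∎
        where
          c = Coalgebra.structure E
          ηA = η.component carrier
          λA = dist.component carrier

  T̄B₁ : ∀ {A B} → BloomHom F A B → BloomHom F (T̄B₀ A) (T̄B₀ B)
  T̄B₁ {A} {B} h = record
    { algebraHom = record
      { map = T.F₁ map
      ; commutes = begin
          (T.F₁ B.structure ∘ dist.component B.carrier) ∘ F.F₁ (T.F₁ map)
            ≈⟨ assoc ⟩
          T.F₁ B.structure ∘ dist.component B.carrier ∘ F.F₁ (T.F₁ map)
            ≈⟨ ∘-congˡ (dist.natural map) ⟩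
          T.F₁ B.structure ∘ T.F₁ (F.F₁ map) ∘ dist.component A.carrier
            ≈⟨ assoc ⟨
          (T.F₁ B.structure ∘ T.F₁ (F.F₁ map)) ∘ dist.component A.carrier
            ≈⟨ ∘-congʳ T.homomorphism ⟨
          T.F₁ (B.structure ∘ F.F₁ map) ∘ dist.component A.carrier
            ≈⟨ ∘-congʳ (T.F-resp-≈ commutes) ⟩
          T.F₁ (map ∘ A.structure) ∘ dist.component A.carrier
            ≈⟨ ∘-congʳ T.homomorphism ⟩
          (T.F₁ map ∘ T.F₁ A.structure) ∘ dist.component A.carrier
            ≈⟨ assoc ⟩
          T.F₁ map ∘ T.F₁ A.structure ∘ dist.component A.carrier ∎
      }
    ; preserves-† = λ E → begin
        T.F₁ map ∘ η.component A.carrier ∘ E A.†     ≈⟨ assoc ⟨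
        (T.F₁ map ∘ η.component A.carrier) ∘ E A.†   ≈⟨ ∘-congʳ (η.natural map) ⟨
        (η.component B.carrier ∘ map) ∘ E A.†        ≈⟨ assoc ⟩
        η.component B.carrier ∘ map ∘ E A.†          ≈⟨ ∘-congˡ (preserves-† E) ⟩
        η.component B.carrier ∘ E B.†                ∎
    }
    where
      open BloomHom h
      open HomReasoning
      module A = BloomAlgebra A
      module B = BloomAlgebra B

  T̄B : Functor (AlgB F) (AlgB F)
  T̄B = record
    { F₀ = T̄B₀
    ; F₁ = T̄B₁
    ; identity = T.identity
    ; homomorphism = T.homomorphism
    ; F-resp-≈ = T.F-resp-≈
    }

{-# OPTIONS --safe #-}
module Submission where

open import Defs
open import Level using (Level)
open import Data.Product using (Σ-syntax; _×_; _,_)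

-- Morphisms of `AlgB F` are compared through their underlying maps in `C`, and `T̄B` acts on those
-- maps as `T`. Naturality and the monad laws are therefore inherited from `T`; the content is that
-- each `η_A` and `μ_A` is a Bloom homomorphism. Each is an `F`-algebra homomorphism by the matching
-- axiom of the distributive law followed by naturality at the algebra structure. For solutions,
-- `η_A` preserves them by the definition of those in `T̄B`, and `μ_A` by a unit law of the monad.

module _ {o ℓ e : Level} {C : Category o ℓ e} {F T : Functor C C}
         {μ : NaturalTransformation (T ∘F T) T} {η : NaturalTransformation idF T}
         (dist : DistributiveLaw F T μ η) where
  open Category C
  open HomReasoning
  private
    module F = Functor F
    module T = Functor T
    module μ = NaturalTransformation μ
    module η = NaturalTransformation η
    module dist = DistributiveLaw dist

  η-algebraHom : (A : Algebra F) → AlgebraHom F A (T̄ dist A)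
  η-algebraHom A = record
    { map = η.component carrier
    ; commutes = begin
        (T.F₁ structure ∘ dist.component carrier) ∘ F.F₁ (η.component carrier) ≈⟨ assoc ⟩
        T.F₁ structure ∘ dist.component carrier ∘ F.F₁ (η.component carrier)   ≈⟨ ∘-congˡ (dist.law-η carrier) ⟩
        T.F₁ structure ∘ η.component (F.F₀ carrier)                            ≈⟨ η.natural structure ⟨
        η.component carrier ∘ structure                                        ∎
    }
    where open Algebra A

  -- `law-μ` trades `λ_A ∘ F μ_A` for `μ_FA` after two uses of `λ`, one for each layer of `T`.
  -- Naturality of `μ` at the structure map then pulls `μ` to the front, and functoriality of `T`
  -- reassembles what remains into the structure of `T̄ (T̄ A)`.
  μ-algebraHom : (A : Algebra F) → AlgebraHom F (T̄ dist (T̄ dist A)) (T̄ dist A)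
  μ-algebraHom A = record
    { map = μA
    ; commutes = begin
        (T.F₁ structure ∘ λA) ∘ F.F₁ μA                                    ≈⟨ assoc ⟩
        T.F₁ structure ∘ λA ∘ F.F₁ μA                                      ≈⟨ ∘-congˡ (dist.law-μ carrier) ⟩
        T.F₁ structure ∘ μ.component (F.F₀ carrier) ∘ T.F₁ λA ∘ λTA        ≈⟨ assoc ⟨
        (T.F₁ structure ∘ μ.component (F.F₀ carrier)) ∘ T.F₁ λA ∘ λTA      ≈⟨ ∘-congʳ (μ.natural structure) ⟨
        (μA ∘ T.F₁ (T.F₁ structure)) ∘ T.F₁ λA ∘ λTA                       ≈⟨ assoc ⟩
        μA ∘ T.F₁ (T.F₁ structure) ∘ T.F₁ λA ∘ λTA                         ≈⟨ ∘-congˡ assoc ⟨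
        μA ∘ (T.F₁ (T.F₁ structure) ∘ T.F₁ λA) ∘ λTA                       ≈⟨ ∘-congˡ (∘-congʳ T.homomorphism) ⟨
        μA ∘ T.F₁ (T.F₁ structure ∘ λA) ∘ λTA                              ∎
    }
    where
      open Algebra A
      μA = μ.component carrier
      λA = dist.component carrier
      λTA = dist.component (T.F₀ carrier)

  ηB : NaturalTransformation idF (T̄B dist)
  ηB = record
    { component = λ A → record
      { algebraHom = η-algebraHom (BloomAlgebra.algebra A)
      -- The solution of a coalgebra in `T̄B A` is defined as `η_A ∘ E †`, so both sides are the
      -- same term.
      ; preserves-† = λ _ → ≈-refl
      }
    ; natural = λ h → η.natural (BloomHom.map h)
    }

  module _ (isMonad : IsMonad T μ η) where
    open IsMonad isMonad

    μB : NaturalTransformation (T̄B dist ∘F T̄B dist) (T̄B dist)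
    μB = record
      { component = λ A → let open BloomAlgebra A in record
        { algebraHom = μ-algebraHom algebra
        ; preserves-† = λ E → begin
            -- Two applications of `T̄B` put two units in front of `E †`; `μ_A` cancels the outer
            -- one, `η_TA`.
            μ.component carrier ∘ η.component (T.F₀ carrier) ∘ η.component carrier ∘ E †   ≈⟨ assoc ⟨
            (μ.component carrier ∘ η.component (T.F₀ carrier)) ∘ η.component carrier ∘ E † ≈⟨ ∘-congʳ (μ-ηT carrier) ⟩
            id ∘ η.component carrier ∘ E †                                                 ≈⟨ identityˡ ⟩
            η.component carrier ∘ E †                                                      ∎
        }
      ; natural = λ h → μ.natural (BloomHom.map h)
      }

    T̄B-isMonad : IsMonad (T̄B dist) μB ηB
    T̄B-isMonad = record
      -- Each law is an equation between underlying maps, hence literally the law of `T` at the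
      -- carrier.
      { μ-assoc = λ A → μ-assoc (BloomAlgebra.carrier A)
      ; μ-Tη    = λ A → μ-Tη (BloomAlgebra.carrier A)
      ; μ-ηT    = λ A → μ-ηT (BloomAlgebra.carrier A)
      }

theorem4p8 : {o ℓ e : Level} (C : Category o ℓ e) (coproducts : BinaryCoproducts C)
  (F T : Functor C C)
  (μ : NaturalTransformation (T ∘F T) T) (η : NaturalTransformation idF T)
  (isMonad : IsMonad T μ η)
  (dist : DistributiveLaw F T μ η)
  (initialAlgebras : (X : Category.Obj C) → Initial (Alg ((F ⟨-⟩+ X) coproducts)))
  (terminalCoalgebra : Terminal (Coalg F))
  (algebraCoproducts : BinaryCoproducts (Alg F)) →
  let open Category C using (_≈_)
      open NaturalTransformation using (component)
  in
  Σ[ μB ∈ NaturalTransformation (T̄B dist ∘F T̄B dist) (T̄B dist) ]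
  Σ[ ηB ∈ NaturalTransformation idF (T̄B dist) ]
    ( ((A : BloomAlgebra F) →
         BloomHom.map (component μB A) ≈ component μ (BloomAlgebra.carrier A))
    × ((A : BloomAlgebra F) →
         BloomHom.map (component ηB A) ≈ component η (BloomAlgebra.carrier A))
    × IsMonad (T̄B dist) μB ηB )
theorem4p8 C _ _ _ _ _ isMonad dist _ _ _ =
  -- The components have `μ_A` and `η_A` as their underlying maps by construction, so reflexivity
  -- identifies them.
  μB dist isMonad , ηB dist , (λ _ → ≈-refl) , (λ _ → ≈-refl) , T̄B-isMonad dist isMonad
  where open Category C
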